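{- There exists an infinite $7/3$-power-free word over $\{0,1\}$ that contains a square beginning at every position.
   Context: A finite word $w$ is an $\alpha$-power ($\alpha$ rational) if $w = x^n x'$ with $x$ nonempty, $x'$ a prefix of $x$, and $\alpha = n + |x'|/|x|$. A word is $\alpha$-power-free if none of its factors (contiguous subwords) is an $\alpha$-power. A square is a word $xx$ with $x$ nonempty. -}

module Defs where

open import Data.Integer using (+_)
open import Data.List using (List; length; _++_; concat; replicate; applyUpTo)
open import Data.List.Relation.Binary.Prefix.Heterogeneous using (Prefix)
open import Data.Nat as ℕ using (ℕ; NonZero)
open import Data.Product using (∃-syntax; _×_)
open import Data.Rational using (ℚ; _/_; _+_; _≤_)
open import Relation.Binary.PropositionalEquality using (_≡_)
open import Relation.Nullary using (¬_)

private
  variable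
    A : Set

record IsPower (α : ℚ) (w : List A) : Set where
  field
    x            : List A
    x′           : List A
    n            : ℕ
    {{nonempty}} : NonZero (length x)
    prefix       : Prefix _≡_ x′ x
    word         : w ≡ concat (replicate n x) ++ x′
    exponent     : α ≡ (+ n / 1) + (+ length x′ / length x)

IsSquare : List A → Set
IsSquare w = ∃[ x ] NonZero (length x) × w ≡ x ++ x

InfiniteWord : Set → Set
InfiniteWord A = ℕ → A

-- The factor w(i) w(i+1) … w(i+ℓ-1).
factor : InfiniteWord A → ℕ → ℕ → List A
factor w i ℓ = applyUpTo (λ k → w (i ℕ.+ k)) ℓ

-- Following the usual convention for rational exponents, α-power-freeness
-- forbids every exponent β ≥ α, in particular α itself. Forbidding only the
-- exact exponent would be weaker: the words 000 and 01010 have exponents 3 and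
-- 5/2, but no factor of either has exponent exactly 7/3.
PowerFree : ℚ → InfiniteWord A → Set
PowerFree α w = ∀ β → α ≤ β → ∀ i ℓ → ¬ IsPower β (factor w i ℓ)

SquareAt : InfiniteWord A → ℕ → Set
SquareAt w i = ∃[ ℓ ] IsSquare (factor w i ℓ)

{-# OPTIONS --safe #-}
-- Let μ be the Thue–Morse morphism and let w be the word with w = 0 μ²(w).
--
-- Power-freeness. Suppose w has a factor of period p and exponent at least 7/3. In a word
-- μ(u), a repetition of odd period p cannot be longer than 2p: comparing it with its shift,
-- which has the other parity, shows that its letters alternate, and p is odd. Hence p is a
-- multiple of 4, and the repetition comes from one of period p/4 in w. The initial letter 0
-- costs at most one letter, and rounding up to whole blocks μ²(a) regains it, so the exponent
-- is still at least 7/3: infinite descent on p.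
--
-- Squares. The prefix 001100110 has period 4, and applying u ↦ 0 μ²(u) repeatedly to it gives
-- runs of period 4^(k+1), which contain squares at all positions from (4^k - 1)/3 to
-- (4^(k+1) - 1)/3.
module Submission where

open import Defs
open import Data.Empty using (⊥-elim)
open import Data.Fin using (Fin; zero; suc; toℕ; opposite)
open import Data.Fin.Properties using (opposite-involutive)
open import Data.Integer as ℤ using (+_)
import Data.Integer.Properties as ℤ
open import Data.List using (List; []; _∷_; _++_; length; concat; replicate; applyUpTo)
open import Data.List.Properties using (length-applyUpTo; length-++; ++-assoc)
open import Data.List.Relation.Binary.Prefix.Heterogeneous using (Prefix; []; _∷_; _++ᵖ_)
open import Data.Nat hiding (_/_)
open import Data.Nat.DivMod using (_divMod_; result)
open import Data.Nat.Induction using (<-rec)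
open import Data.Nat.Properties
open import Data.Nat.Tactic.RingSolver using (solve-∀)
open import Data.Product using (Σ-syntax; ∃-syntax; ∃₂; _×_; _,_)
open import Data.Rational as ℚ using (_/_; toℚᵘ)
import Data.Rational.Properties as ℚ
open import Data.Rational.Unnormalised as ℚᵘ using (mkℚᵘ; _≃_)
import Data.Rational.Unnormalised.Properties as ℚᵘ
open import Function using (_∘_)
open import Relation.Binary.PropositionalEquality
open import Relation.Nullary using (¬_; yes; no)

private
  variable
    A : Set
    p i l : ℕ

-- Repetitions and rounded-up halves

-- `l` counts the compared positions, so the repetition has length `p + l`; a square is the case
-- `l = p`.
record Repeats {A : Set} (u : InfiniteWord A) (p i l : ℕ) : Set where
  constructor repeats
  field
    shift-≡ : ∀ k → k < l → u (p + (i + k)) ≡ u (i + k)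

open Repeats

-- A factor of period p and length p + l has exponent at least 7/3 iff 4p ≤ 3l.
HasPower : InfiniteWord A → ℕ → Set
HasPower u p = ∃₂ λ i l → Repeats u p i l × 4 * p ≤ 3 * l

-- `⌈ n /2⌉` is the number of even positions below `n`: what survives when every other comparison is
-- kept.
<⌈/2⌉⇒*2< : ∀ k n → k < ⌈ n /2⌉ → k * 2 < n
<⌈/2⌉⇒*2< zero    (suc n)       _         = z<s
<⌈/2⌉⇒*2< (suc k) (suc (suc n)) (s<s k<n) = s<s (s<s (<⌈/2⌉⇒*2< k n k<n))

*2<⇒<⌈/2⌉ : ∀ k n → k * 2 < n → k < ⌈ n /2⌉
*2<⇒<⌈/2⌉ zero    (suc n)       _               = z<s
*2<⇒<⌈/2⌉ (suc k) (suc (suc n)) (s<s (s<s k<n)) = s<s (*2<⇒<⌈/2⌉ k n k<n)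
*2<⇒<⌈/2⌉ (suc k) (suc zero)    (s<s ())

n≤⌈n/2⌉*2 : ∀ n → n ≤ ⌈ n /2⌉ * 2
n≤⌈n/2⌉*2 zero          = z≤n
n≤⌈n/2⌉*2 (suc zero)    = s≤s z≤n
n≤⌈n/2⌉*2 (suc (suc n)) = s≤s (s≤s (n≤⌈n/2⌉*2 n))

-- The Thue–Morse morphism

μ : InfiniteWord (Fin 2) → InfiniteWord (Fin 2)
μ u zero          = u 0
μ u (suc zero)    = opposite (u 0)
μ u (suc (suc n)) = μ (u ∘ suc) n

μ-cong : ∀ {u v} n → (∀ m → m ≤ n → u m ≡ v m) → μ u n ≡ μ v n
μ-cong zero          eq = eq 0 z≤n
μ-cong (suc zero)    eq = cong opposite (eq 0 z≤n)
μ-cong (suc (suc n)) eq = μ-cong n λ m m≤n → eq (suc m) (s≤s (m≤n⇒m≤1+n m≤n))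

letter : Fin 2 → Fin 2 → Fin 2
letter zero       a = a
letter (suc zero) a = opposite a

μ-letter : ∀ u r q → μ u (toℕ r + q * 2) ≡ letter r (u q)
μ-letter u zero       zero    = refl
μ-letter u (suc zero) zero    = refl
μ-letter u zero       (suc q) = μ-letter (u ∘ suc) zero q
μ-letter u (suc zero) (suc q) = μ-letter (u ∘ suc) (suc zero) q

opposite-injective : ∀ {a b : Fin 2} → opposite a ≡ opposite b → a ≡ b
opposite-injective {a} {b} eq =
  trans (sym (opposite-involutive a)) (trans (cong opposite eq) (opposite-involutive b))

letter-injective : ∀ r {a b} → letter r a ≡ letter r b → a ≡ b
letter-injective zero       eq = eq
letter-injective (suc zero) eq = opposite-injective eq

opposite-≢ : ∀ (a : Fin 2) → opposite a ≢ a
opposite-≢ zero       ()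
opposite-≢ (suc zero) ()

μ-pair : ∀ u q → μ u (suc (q * 2)) ≡ opposite (μ u (q * 2))
μ-pair u q = trans (μ-letter u (suc zero) q) (cong opposite (sym (μ-letter u zero q)))

-- A shift by `p * 2` moves by whole blocks, so compared letters share the offset `r` and come from
-- letters at distance `p`.
Repeats-μ⁺ : ∀ {u} → Repeats u p i l → Repeats (μ u) (p * 2) (i * 2) (l * 2)
Repeats-μ⁺ {p} {i} {l} {u} rep .shift-≡ k k<l*2 with k divMod 2
... | result q r refl = begin
  μ u (p * 2 + (i * 2 + (toℕ r + q * 2)))  ≡⟨ cong (μ u) (shuffle p i (toℕ r) q) ⟩
  μ u (toℕ r + (p + (i + q)) * 2)          ≡⟨ μ-letter u r _ ⟩
  letter r (u (p + (i + q)))               ≡⟨ cong (letter r) (shift-≡ rep q q<l) ⟩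
  letter r (u (i + q))                     ≡⟨ μ-letter u r _ ⟨
  μ u (toℕ r + (i + q) * 2)                ≡⟨ cong (μ u) (shuffle 0 i (toℕ r) q) ⟨
  μ u (i * 2 + (toℕ r + q * 2))            ∎
  where
  open ≡-Reasoning
  shuffle : ∀ p i r q → p * 2 + (i * 2 + (r + q * 2)) ≡ r + (p + (i + q)) * 2
  shuffle = solve-∀
  q<l : q < l
  q<l = *-cancelʳ-< 2 q l (≤-<-trans (m≤n+m (q * 2) (toℕ r)) k<l*2)

-- Every other letter of the repetition lies at the same place r of its block, and any letter
-- of μ(a) determines a.
Repeats-μ⁻ : ∀ {u} → Repeats (μ u) (p * 2) i l → ∃[ j ] Repeats u p j ⌈ l /2⌉
Repeats-μ⁻ {p} {i} {l} {u} rep with i divMod 2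
... | result j r refl = j , repeats λ k k<l → letter-injective r (begin
  letter r (u (p + (j + k)))               ≡⟨ μ-letter u r _ ⟨
  μ u (toℕ r + (p + (j + k)) * 2)          ≡⟨ cong (μ u) (shuffle p j (toℕ r) k) ⟩
  μ u (p * 2 + (toℕ r + j * 2 + k * 2))    ≡⟨ shift-≡ rep (k * 2) (<⌈/2⌉⇒*2< k l k<l) ⟩
  μ u (toℕ r + j * 2 + k * 2)              ≡⟨ cong (μ u) (shuffle 0 j (toℕ r) k) ⟨
  μ u (toℕ r + (j + k) * 2)                ≡⟨ μ-letter u r _ ⟩
  letter r (u (j + k))                     ∎)
  where
  open ≡-Reasoning
  shuffle : ∀ p j r k → r + (p + (j + k)) * 2 ≡ p * 2 + (r + j * 2 + k * 2)
  shuffle = solve-∀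

alternating-even : ∀ (f : ℕ → Fin 2) q → (∀ k → k < q * 2 → f (suc k) ≡ opposite (f k)) →
                   f (q * 2) ≡ f 0
alternating-even f zero    alt = refl
alternating-even f (suc q) alt = begin
  f (2 + q * 2)                    ≡⟨ alt _ ≤-refl ⟩
  opposite (f (1 + q * 2))         ≡⟨ cong opposite (alt _ (n≤1+n _)) ⟩
  opposite (opposite (f (q * 2)))  ≡⟨ opposite-involutive _ ⟩
  f (q * 2)                        ≡⟨ alternating-even f q (λ k k< → alt k (m≤n⇒m≤1+n (m≤n⇒m≤1+n k<))) ⟩
  f 0                              ∎
  where open ≡-Reasoning

-- Alternating letters at the odd distance `p = suc (q * 2)` differ, against comparison 0.
-- Alternation for all `k < p` uses comparisons up to index `p`, hence `p < l`.
μ-no-odd-repetition : ∀ {u} q → suc (q * 2) < l → ¬ Repeats (μ u) (suc (q * 2)) i l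
μ-no-odd-repetition {l} {i} {u} q p<l rep = opposite-≢ (μ u (i + 0)) (begin
  opposite (μ u (i + 0))      ≡⟨ cong opposite (alternating-even (λ k → μ u (i + k)) q (λ k → alternates k ∘ m≤n⇒m≤1+n)) ⟨
  opposite (μ u (i + q * 2))  ≡⟨ alternates (q * 2) ≤-refl ⟨
  μ u (i + suc (q * 2))       ≡⟨ cong (μ u) (shuffle i q) ⟩
  μ u (suc (q * 2) + (i + 0)) ≡⟨ shift-≡ rep 0 (≤-trans z<s p<l) ⟩
  μ u (i + 0)                 ∎)
  where
  open ≡-Reasoning
  shuffle : ∀ i q → i + suc (q * 2) ≡ suc (q * 2) + (i + 0)
  shuffle = solve-∀
  shuffle-suc : ∀ q i k → suc (q * 2) + (i + suc k) ≡ suc (suc (q * 2) + (i + k))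
  shuffle-suc = solve-∀
  shuffle-odd : ∀ q j → suc (q * 2) + (1 + j * 2) ≡ (suc (q + j)) * 2
  shuffle-odd = solve-∀
  alternates : ∀ k → k < suc (q * 2) → μ u (i + suc k) ≡ opposite (μ u (i + k))
  alternates k k<p with (i + k) divMod 2
  ... | result j zero eq = begin
    μ u (i + suc k)          ≡⟨ cong (μ u) (trans (+-suc i k) (cong suc eq)) ⟩
    μ u (suc (j * 2))        ≡⟨ μ-pair u j ⟩
    opposite (μ u (j * 2))   ≡⟨ cong (opposite ∘ μ u) eq ⟨
    opposite (μ u (i + k))   ∎
  -- At an odd position the pair straddles two blocks. The odd shift moves it into a single block,
  -- and comparisons `suc k` and `k` bring the result back.
  ... | result j (suc zero) eq = begin
    μ u (i + suc k)                             ≡⟨ shift-≡ rep (suc k) (≤-<-trans k<p p<l) ⟨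
    μ u (suc (q * 2) + (i + suc k))             ≡⟨ cong (μ u) (shuffle-suc q i k) ⟩
    μ u (suc (suc (q * 2) + (i + k)))           ≡⟨ cong (μ u ∘ suc) even ⟩
    μ u (suc (suc (q + j) * 2))                 ≡⟨ μ-pair u (suc (q + j)) ⟩
    opposite (μ u (suc (q + j) * 2))            ≡⟨ cong (opposite ∘ μ u) even ⟨
    opposite (μ u (suc (q * 2) + (i + k)))      ≡⟨ cong opposite (shift-≡ rep k (<-trans k<p p<l)) ⟩
    opposite (μ u (i + k))                      ∎
    where
    even : suc (q * 2) + (i + k) ≡ suc (q + j) * 2
    even = trans (cong (λ n → suc (q * 2) + n) eq) (shuffle-odd q j)

-- The word w = 0 μ²(w)

-- approx f agrees with w on the positions up to f.
approx : ℕ → InfiniteWord (Fin 2)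
approx zero    _       = zero
approx (suc f) zero    = zero
approx (suc f) (suc n) = μ (μ (approx f)) n

w : InfiniteWord (Fin 2)
w n = approx n n

approx-stable : ∀ f g n → n ≤ f → n ≤ g → approx f n ≡ approx g n
approx-stable zero    zero    zero    _         _         = refl
approx-stable zero    (suc g) zero    _         _         = refl
approx-stable (suc f) zero    zero    _         _         = refl
approx-stable (suc f) (suc g) zero    _         _         = refl
approx-stable (suc f) (suc g) (suc n) (s≤s n≤f) (s≤s n≤g) =
  μ-cong n λ m m≤n → μ-cong m λ k k≤m →
    let k≤n = ≤-trans k≤m m≤n in
    approx-stable f g k (≤-trans k≤n n≤f) (≤-trans k≤n n≤g)

-- Unfolding `w (suc n)` leaves `approx n` throughout, whereas `w k` is `approx k k`; stability
-- closes the gap.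
w-suc : ∀ n → w (suc n) ≡ μ (μ w) n
w-suc n = μ-cong n λ m m≤n → μ-cong m λ k k≤m → approx-stable n k k (≤-trans k≤m m≤n) ≤-refl

w-repeats-suc⁻ : Repeats w p (suc i) l → Repeats (μ (μ w)) p i l
w-repeats-suc⁻ {p} {i} rep .shift-≡ k k<l = begin
  μ (μ w) (p + (i + k))  ≡⟨ w-suc (p + (i + k)) ⟨
  w (suc (p + (i + k)))  ≡⟨ cong w (+-suc p (i + k)) ⟨
  w (p + suc (i + k))    ≡⟨ shift-≡ rep k k<l ⟩
  w (suc (i + k))        ≡⟨ w-suc (i + k) ⟩
  μ (μ w) (i + k)        ∎
  where open ≡-Reasoning

w-repeats-suc⁺ : Repeats (μ (μ w)) p i l → Repeats w p (suc i) l
w-repeats-suc⁺ {p} {i} rep .shift-≡ k k<l = begin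
  w (p + suc (i + k))    ≡⟨ cong w (+-suc p (i + k)) ⟩
  w (suc (p + (i + k)))  ≡⟨ w-suc (p + (i + k)) ⟩
  μ (μ w) (p + (i + k))  ≡⟨ shift-≡ rep k k<l ⟩
  μ (μ w) (i + k)        ≡⟨ w-suc (i + k) ⟨
  w (suc (i + k))        ∎
  where open ≡-Reasoning

-- Power-freeness

-- Only a repetition at position 0 loses a letter, and none of period at most 3 starts there.
w-power⇒μμw-repeats : ∀ p .{{_ : NonZero p}} → HasPower w p →
  ∃₂ λ i l → Repeats (μ (μ w)) p i l × p < l × 4 * p ≤ 3 + 3 * l
w-power⇒μμw-repeats p@(suc p-1) (i , l , rep , 4p≤3l) = go p i l p<l rep 4p≤3l
  where
  p<l : p < l
  p<l = *-cancelˡ-< 3 p l (≤-trans (m<n+m (3 * p) z<s) 4p≤3l)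
  go : ∀ p i l → p < l → Repeats w p i l → 4 * p ≤ 3 * l →
       ∃₂ λ i l → Repeats (μ (μ w)) p i l × p < l × 4 * p ≤ 3 + 3 * l
  go p (suc i) l p<l rep 4p≤3l =
    i , l , w-repeats-suc⁻ rep , p<l , m≤n⇒m≤o+n 3 4p≤3l
  go 0 zero (suc l) p<l rep 4p≤3l = 0 , suc l , repeats (λ _ _ → refl) , p<l , z≤n
  -- `w` begins with 0011. Period 1 shows no conflict at position 0, so position 1 is compared;
  -- periods 2 and 3 fail at position 0.
  go 1 zero l p<l rep _ with () ← shift-≡ rep 1 p<l
  go 2 zero l p<l rep _ with () ← shift-≡ rep 0 (<-trans z<s p<l)
  go 3 zero l p<l rep _ with () ← shift-≡ rep 0 (<-trans z<s p<l)
  go p@(suc (suc (suc (suc m)))) zero (suc l) p<l rep 4p≤3l =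
    0 , l , w-repeats-suc⁻ (repeats λ k k<l → shift-≡ rep (suc k) (s<s k<l)) ,
    s<s⁻¹ (*-cancelˡ-< 3 (suc p) (suc l) (≤-trans bound 4p≤3l)) ,
    ≤-trans 4p≤3l (≤-reflexive (*-suc 3 l))
    where
    regroup : ∀ m → suc (3 * (5 + m)) + m ≡ 4 * (4 + m)
    regroup = solve-∀
    -- True only for `p > 3`, hence the separate small periods; it keeps `p < l` after the loss of a
    -- letter.
    bound : 3 * suc p < 4 * p
    bound = ≤-trans (m≤m+n _ m) (≤-reflexive (regroup m))

-- Rounding up to whole blocks absorbs the summand 3.
descent-bound : ∀ s l → 4 * (s * 2 * 2) ≤ 3 + 3 * l → 4 * s ≤ 3 * ⌈ ⌈ l /2⌉ /2⌉
descent-bound s l bound with 4 * s ≤? 3 * ⌈ ⌈ l /2⌉ /2⌉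
... | yes le = le
-- By integrality, failure means `3 * L + 1 ≤ 4 * s`; multiplied by 4, the 1 becomes 4, which
-- exceeds the summand 3.
... | no  nle = ⊥-elim (<⇒≱ chain ≤-refl)
  where
  L = ⌈ ⌈ l /2⌉ /2⌉
  scale : ∀ s → 4 * (s * 2 * 2) ≡ 4 * (4 * s)
  scale = solve-∀
  unscale : ∀ L → 4 + 3 * (L * 2 * 2) ≡ 4 * suc (3 * L)
  unscale = solve-∀
  open ≤-Reasoning
  chain : 4 * (s * 2 * 2) < 4 * (s * 2 * 2)
  chain = begin-strict
    4 * (s * 2 * 2)      ≤⟨ bound ⟩
    3 + 3 * l            ≤⟨ +-monoʳ-≤ 3 (*-monoʳ-≤ 3 (≤-trans (n≤⌈n/2⌉*2 l) (*-monoˡ-≤ 2 (n≤⌈n/2⌉*2 ⌈ l /2⌉)))) ⟩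
    3 + 3 * (L * 2 * 2)  <⟨ n<1+n _ ⟩
    4 + 3 * (L * 2 * 2)  ≡⟨ unscale L ⟩
    4 * suc (3 * L)      ≤⟨ *-monoʳ-≤ 4 (≰⇒> nle) ⟩
    4 * (4 * s)          ≡⟨ scale s ⟨
    4 * (s * 2 * 2)      ∎

w-power-free : ∀ p → .{{_ : NonZero p}} → ¬ HasPower w p
w-power-free = <-rec _ step
  where
  step : ∀ p → (∀ {q} → q < p → .{{_ : NonZero q}} → ¬ HasPower w q) →
         .{{_ : NonZero p}} → ¬ HasPower w p
  step p rec power with w-power⇒μμw-repeats p power
  ... | i , l , rep , p<l , bound with p divMod 2
  ...   | result q (suc zero) refl = μ-no-odd-repetition q p<l rep
  ...   | result q zero refl with Repeats-μ⁻ {p = q} rep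
  ...     | j , rep′ with q divMod 2
  ...       | result s (suc zero) refl = μ-no-odd-repetition s (*2<⇒<⌈/2⌉ _ l p<l) rep′
  ...       | result s@(suc s-1) zero refl with Repeats-μ⁻ {p = s} rep′
  ...         | h , rep″ = rec (≤-trans (m<m*n s 2 ≤-refl) (m≤m*n (s * 2) 2))
                             (h , _ , rep″ , descent-bound s l bound)

-- From rational exponents to periods

-- Being a prefix of `x` followed by itself encodes having period `length x`. Cancelling `n` copies
-- of `x` leaves `x′`, a prefix of `x`.
power-prefix : ∀ {x x′ : List A} n → Prefix _≡_ x′ x →
  Prefix _≡_ (concat (replicate n x) ++ x′) (x ++ concat (replicate n x) ++ x′)
power-prefix         zero    pre = pre ++ᵖ _
power-prefix {x = x} {x′} (suc n) pre
  rewrite ++-assoc x (concat (replicate n x)) x′ = prepend x (power-prefix n pre)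
  where
  prepend : ∀ {as bs : List A} xs → Prefix _≡_ as bs → Prefix _≡_ (xs ++ as) (xs ++ bs)
  prepend []       pre = pre
  prepend (y ∷ ys) pre = refl ∷ prepend ys pre

-- `f` and `g` are kept apart because peeling off `x` advances only `g`; the application takes them
-- equal.
prefix⇒shift-≡ : ∀ (x : List A) f g m n k →
  Prefix _≡_ (applyUpTo g n) (x ++ applyUpTo f m) → length x + k < n → k < m →
  g (length x + k) ≡ f k
prefix⇒shift-≡ []       f g (suc m) (suc n) zero    (eq ∷ pre) _         _         = eq
prefix⇒shift-≡ []       f g (suc m) (suc n) (suc k) (_  ∷ pre) (s<s k<n) (s<s k<m) =
  prefix⇒shift-≡ [] (f ∘ suc) (g ∘ suc) m n k pre k<n k<m
prefix⇒shift-≡ (_ ∷ x) f g m       (suc n) k       (_  ∷ pre) (s<s k<n) k<m       =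
  prefix⇒shift-≡ x f (g ∘ suc) m n k pre k<n k<m

length-power : ∀ (x : List A) n → length (concat (replicate n x)) ≡ n * length x
length-power x zero    = refl
length-power x (suc n) = trans (length-++ x) (cong (λ m → length x + m) (length-power x n))

-- Fractions in `ℚ` are reduced to lowest terms; among unnormalised ones the denominators stay 3 and
-- `1 * p`, ready for cross-multiplication.
exponent-bound : ∀ n a p .{{_ : NonZero p}} →
  + 7 / 3 ℚ.≤ + n / 1 ℚ.+ + a / p → 7 * p ≤ 3 * (n * p + a)
exponent-bound n a p@(suc p-1) le = begin
  7 * p                    ≡⟨ cong (7 *_) (*-identityˡ p) ⟨
  7 * (1 * p)              ≤⟨ ℤ.drop‿+≤+ (subst₂ ℤ._≤_ (sym (ℤ.pos-* 7 (1 * p))) numerator (ℚᵘ.drop-*≤* le′)) ⟩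
  (n * p + a * 1) * 3      ≡⟨ cong (λ b → (n * p + b) * 3) (*-identityʳ a) ⟩
  (n * p + a) * 3          ≡⟨ *-comm (n * p + a) 3 ⟩
  3 * (n * p + a)          ∎
  where
  open ≤-Reasoning
  homo : toℚᵘ (+ n / 1 ℚ.+ + a / p) ≃ mkℚᵘ (+ n) 0 ℚᵘ.+ mkℚᵘ (+ a) p-1
  homo = ℚᵘ.≃-trans (ℚ.toℚᵘ-homo-+ (+ n / 1) (+ a / p))
           (ℚᵘ.+-cong (ℚ.toℚᵘ-fromℚᵘ (mkℚᵘ (+ n) 0)) (ℚ.toℚᵘ-fromℚᵘ (mkℚᵘ (+ a) p-1)))
  le′ : mkℚᵘ (+ 7) 2 ℚᵘ.≤ mkℚᵘ (+ n) 0 ℚᵘ.+ mkℚᵘ (+ a) p-1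
  le′ = ℚᵘ.≤-respʳ-≃ homo (ℚ.toℚᵘ-mono-≤ le)
  numerator : (+ n ℤ.* + p ℤ.+ + a ℤ.* + 1) ℤ.* + 3 ≡ + ((n * p + a * 1) * 3)
  numerator = trans
    (cong (ℤ._* + 3) (trans (cong₂ ℤ._+_ (sym (ℤ.pos-* n p)) (sym (ℤ.pos-* a 1)))
                            (sym (ℤ.pos-+ (n * p) (a * 1)))))
    (sym (ℤ.pos-* (n * p + a * 1) 3))

-- The overlap is what remains of the factor after one period `q`, so subtracting `3 * q` from
-- `7 * q ≤ 3 * ℓ` gives the bound.
IsPower⇒HasPower : ∀ {β} (u : InfiniteWord A) i ℓ → + 7 / 3 ℚ.≤ β →
  (power : IsPower β (factor u i ℓ)) → HasPower u (length (IsPower.x power))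
IsPower⇒HasPower u i ℓ 7/3≤β power = i , ℓ ∸ q , rep , bound
  where
  open IsPower power
  q = length x
  ℓ≡ : n * q + length x′ ≡ ℓ
  ℓ≡ = begin
    n * q + length x′                            ≡⟨ cong (_+ length x′) (length-power x n) ⟨
    length (concat (replicate n x)) + length x′  ≡⟨ length-++ (concat (replicate n x)) ⟨
    length (concat (replicate n x) ++ x′)        ≡⟨ cong length word ⟨
    length (factor u i ℓ)                        ≡⟨ length-applyUpTo _ ℓ ⟩
    ℓ                                            ∎
    where open ≡-Reasoning
  bound : 4 * q ≤ 3 * (ℓ ∸ q)
  bound = begin
    4 * q            ≤⟨ m+n≤o⇒m≤o∸n (4 * q) 7p≤3ℓ ⟩
    3 * ℓ ∸ 3 * q    ≡⟨ *-distribˡ-∸ 3 ℓ q ⟨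
    3 * (ℓ ∸ q)      ∎
    where
    open ≤-Reasoning
    7p≤3ℓ : 4 * q + 3 * q ≤ 3 * ℓ
    7p≤3ℓ = begin
      4 * q + 3 * q            ≡⟨ *-distribʳ-+ q 4 3 ⟨
      7 * q                    ≤⟨ exponent-bound n (length x′) q (subst (+ 7 / 3 ℚ.≤_) exponent 7/3≤β) ⟩
      3 * (n * q + length x′)  ≡⟨ cong (3 *_) ℓ≡ ⟩
      3 * ℓ                    ∎
  pre : Prefix _≡_ (factor u i ℓ) (x ++ factor u i ℓ)
  pre = subst (λ v → Prefix _≡_ v (x ++ v)) (sym word) (power-prefix n prefix)
  rep : Repeats u q i (ℓ ∸ q)
  rep .shift-≡ k k<ℓ∸q = trans (cong u (shuffle q i k))
    (prefix⇒shift-≡ x (λ k → u (i + k)) (λ k → u (i + k)) ℓ ℓ k pre q+k<ℓ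
      (≤-<-trans (m≤n+m k q) q+k<ℓ))
    where
    shuffle : ∀ a b c → a + (b + c) ≡ b + (a + c)
    shuffle = solve-∀
    q+k<ℓ : q + k < ℓ
    -- Some `k` lies below the truncated difference `ℓ ∸ q`, so `q < ℓ` and the subtraction is
    -- exact.
    q+k<ℓ = subst₂ _<_ (+-comm k q) (m∸n+n≡m {ℓ} {q} (<⇒≤ (m∸n≢0⇒n<m {ℓ} {q} (m<n⇒n≢0 k<ℓ∸q))))
      (+-monoˡ-< q k<ℓ∸q)

-- Squares

applyUpTo-+ : ∀ (f : ℕ → A) m n → applyUpTo f (m + n) ≡ applyUpTo f m ++ applyUpTo (λ k → f (m + k)) n
applyUpTo-+ f zero    n = refl
applyUpTo-+ f (suc m) n = cong (f 0 ∷_) (applyUpTo-+ (f ∘ suc) m n)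

applyUpTo-cong : ∀ {f g : ℕ → A} n → (∀ k → k < n → f k ≡ g k) → applyUpTo f n ≡ applyUpTo g n
applyUpTo-cong zero    eq = refl
applyUpTo-cong (suc n) eq = cong₂ _∷_ (eq 0 z<s) (applyUpTo-cong n λ k k<n → eq (suc k) (s<s k<n))

repeats⇒squareAt : ∀ (u : InfiniteWord A) p i .{{_ : NonZero p}} → Repeats u p i p → SquareAt u i
repeats⇒squareAt u p i rep = p + p , factor u i p ,
  subst NonZero (sym (length-applyUpTo _ p)) (>-nonZero (>-nonZero⁻¹ p)) ,
  trans (applyUpTo-+ _ p p) (cong (factor u i p ++_) (applyUpTo-cong p λ k k<p →
    trans (cong u (shuffle i p k)) (shift-≡ rep k k<p)))
  where
  shuffle : ∀ i p k → i + (p + k) ≡ p + (i + k)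
  shuffle = solve-∀

-- (4^k - 1)/3
start : ℕ → ℕ
start zero    = 0
start (suc k) = suc (start k * 2 * 2)

-- The gap `4 ^ k` is the number of positions at which run `k` must supply a square before the next
-- run takes over.
start-suc : ∀ k → start (suc k) ≡ start k + 4 ^ k
start-suc zero    = refl
start-suc (suc k) = trans (cong (λ n → suc (n * 2 * 2)) (start-suc k)) (shuffle (start k) (4 ^ k))
  where
  shuffle : ∀ a b → suc ((a + b) * 2 * 2) ≡ suc (a * 2 * 2) + 4 * b
  shuffle = solve-∀

-- `5 * 4 ^ k` is one period `4 ^ suc k`, for the square, plus room to slide it by `4 ^ k`. For
-- `k = 0`, the nine letters 001100110 give 5 comparisons at distance 4.
w-run : ∀ k → Repeats w (4 ^ suc k) (start k) (5 * 4 ^ k)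
w-run zero .shift-≡ 0 _ = refl
w-run zero .shift-≡ 1 _ = refl
w-run zero .shift-≡ 2 _ = refl
w-run zero .shift-≡ 3 _ = refl
w-run zero .shift-≡ 4 _ = refl
w-run zero .shift-≡ (suc (suc (suc (suc (suc _))))) (s<s (s<s (s<s (s<s (s<s ())))))
w-run (suc k) = subst₂ (λ p l → Repeats w p (start (suc k)) l) (times4 (4 * 4 ^ k)) (times20 (4 ^ k))
  (w-repeats-suc⁺ (Repeats-μ⁺ (Repeats-μ⁺ (w-run k))))
  where
  times4 : ∀ a → a * 2 * 2 ≡ 4 * a
  times4 = solve-∀
  times20 : ∀ a → 5 * a * 2 * 2 ≡ 5 * (4 * a)
  times20 = solve-∀

between-starts : ∀ i → ∃[ k ] start k ≤ i × i < start (suc k)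
between-starts zero    = 0 , z≤n , z<s
between-starts (suc i) with between-starts i
... | k , lo , hi with suc i <? start (suc k)
...   | yes i< = k , m≤n⇒m≤1+n lo , i<
...   | no  i≮ = suc k , ≮⇒≥ i≮ , s<s (≤-trans hi (≤-trans (m≤m*n _ 2) (m≤m*n _ 2)))

w-squareAt : ∀ i → SquareAt w i
w-squareAt i with between-starts i
... | k , lo , hi with m≤n⇒∃[o]m+o≡n lo
...   | d , refl = repeats⇒squareAt w (4 ^ suc k) i {{m^n≢0 4 (suc k)}} (repeats λ j j<p →
  subst (λ n → w (4 ^ suc k + n) ≡ w n) (sym (+-assoc (start k) d j))
    -- `5 * 4 ^ k` unfolds to `4 ^ k + 4 ^ suc k`, the bounds on `d` and `j`.
    (shift-≡ (w-run k) (d + j) (+-mono-< d<4^k j<p)))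
  where
  d<4^k : d < 4 ^ k
  d<4^k = +-cancelˡ-< (start k) d (4 ^ k) (subst (i <_) (start-suc k) hi)

theorem6 : Σ[ w ∈ InfiniteWord (Fin 2) ] (PowerFree (+ 7 / 3) w × (∀ i → SquareAt w i))
theorem6 = w , (λ β 7/3≤β i ℓ power →
  w-power-free _ {{IsPower.nonempty power}} (IsPower⇒HasPower w i ℓ 7/3≤β power)) , w-squareAt
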